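{- Let $V$ be a finite set of propositional variables, $\mathcal{F}=(V,\Gamma,O_1,\dots,O_n)$ a knowledge structure, $\Delta\subseteq\{1,\dots,n\}$ nonempty, $\mathcal{V}_\Delta=\{O_i\mid i\in\Delta\}$, $\alpha$ a formula over $V$, and let $WSC_\Delta^\alpha$ and $SNC_\Delta^\alpha$ be a weakest $\mathcal{V}_\Delta$-sufficient condition and a strongest $\mathcal{V}_\Delta$-necessary condition, respectively, of $\alpha$ under $\Gamma$. Then, for every state $s$ of $\mathcal{F}$, $$(\mathcal{F},s)\models C_\Delta\alpha\Leftrightarrow WSC_\Delta^\alpha\quad\text{and}\quad(\mathcal{F},s)\models\neg C_\Delta\neg\alpha\Leftrightarrow SNC_\Delta^\alpha .$$
   Context: A formula over a set $P$ of propositional variables is a propositional formula all of whose variables lie in $P$ (the constants $\mathbf{true},\mathbf{false}$ count as formulas over every $P$). A truth assignment over $P$ is identified with a subset of $P$. For a set $\Gamma$ of propositional formulas, $\Gamma\models\varphi$ means that every assignment satisfying all of $\Gamma$ satisfies $\varphi$. A knowledge structure with $n$ agents is a tuple $\mathcal{F}=(V,\Gamma,O_1,\dots,O_n)$ where $V$ is a set of propositional variables, $\Gamma$ is a consistent set of propositional formulas over $V$, and $O_i\subseteq V$ for each agent $i$. A state of $\mathcal{F}$ is an assignment $s\subseteq V$ satisfying $\Gamma$. For states $s,s'$, $(s,s')\in\mathcal{E}_{\mathcal{V}_\Delta}$ iff there is $i\in\Delta$ with $s\cap O_i=s'\cap O_i$; $\mathcal{E}^*_{\mathcal{V}_\Delta}$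 is the transitive closure of $\mathcal{E}_{\mathcal{V}_\Delta}$. Satisfaction $(\mathcal{F},s)\models\varphi$ at a state $s$: $(\mathcal{F},s)\models p$ iff $p\in s$ for variables $p$; Boolean connectives as usual; $(\mathcal{F},s)\models C_\Delta\alpha$ iff $(\mathcal{F},s')\models\alpha$ for all states $s'$ of $\mathcal{F}$ with $(s,s')\in\mathcal{E}^*_{\mathcal{V}_\Delta}$. Let $\mathcal{V}$ be a nonempty set of subsets of $V$, $\Gamma$ a set of formulas over $V$, $\alpha$ a formula over $V$. A formula $\varphi$ over $V$ is $\mathcal{V}$-definable under $\Gamma$ if for each $P\in\mathcal{V}$ there is a formula $\psi_P$ over $P$ with $\Gamma\models\varphi\Leftrightarrow\psi_P$. It is a $\mathcal{V}$-sufficient condition of $\alpha$ under $\Gamma$ if it is $\mathcal{V}$-definable under $\Gamma$ and $\Gamma\models\varphi\Rightarrow\alpha$; a weakest one if moreover $\Gamma\models\varphi'\Rightarrow\varphi$ for every $\mathcal{V}$-sufficient condition $\varphi'$ of $\alpha$ under $\Gamma$. It is a $\mathcal{V}$-necessary condition of $\alpha$ under $\Gamma$ if it is $\mathcal{V}$-definable under $\Gamma$ and $\Gamma\models\alpha\Rightarrow\varphi$; a strongest one if moreover $\Gamma\models\varphi\Rightarrow\varphi'$ for every $\mathcal{V}$-necessary condition $\varphi'$ of $\alpha$ under $\Gamma$. -}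

module Defs where

open import Data.Empty using (⊥)
open import Data.Fin using (Fin)
open import Data.Fin.Subset using (Subset; _∈_; _⊆_; _∩_; _∪_; ⁅_⁆)
  renaming (⊥ to ∅)
open import Data.Nat using (ℕ)
open import Data.Product using (_×_; ∃-syntax)
open import Data.Sum using (_⊎_)
open import Data.Unit using (⊤)
open import Level using (0ℓ)
open import Relation.Binary.Construct.Closure.Transitive using (TransClosure)
open import Relation.Binary.PropositionalEquality using (_≡_)
open import Relation.Nullary using (¬_)
open import Relation.Unary using (Pred)
import Relation.Unary as U

infix  9 ∼_
infixr 8 _∧_
infixr 7 _∨_
infixr 6 _⇒_
infix  5 _⇔_
infix  4 _⊨_ _⊨*_ _⊫_ _over_ _∣_⊩_

-- The variables are the elements of Fin v, so an assignment, identified with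
-- the set of variables it makes true, is a Subset v.
data Formula (v : ℕ) : Set where
  var             : Fin v → Formula v
  true false      : Formula v
  ∼_              : Formula v → Formula v
  _∧_ _∨_ _⇒_ _⇔_ : Formula v → Formula v → Formula v

vars : ∀ {v} → Formula v → Subset v
vars (var p) = ⁅ p ⁆
vars true    = ∅
vars false   = ∅
vars (∼ φ)   = vars φ
vars (φ ∧ ψ) = vars φ ∪ vars ψ
vars (φ ∨ ψ) = vars φ ∪ vars ψ
vars (φ ⇒ ψ) = vars φ ∪ vars ψ
vars (φ ⇔ ψ) = vars φ ∪ vars ψ

_over_ : ∀ {v} → Formula v → Subset v → Set
φ over P = vars φ ⊆ P

-- Membership in a Subset is decidable, hence so is s ⊨ φ; the type-theoretic
-- reading of the connectives therefore agrees with the truth tables.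
_⊨_ : ∀ {v} → Subset v → Formula v → Set
s ⊨ var p   = p ∈ s
s ⊨ true    = ⊤
s ⊨ false   = ⊥
s ⊨ ∼ φ     = ¬ (s ⊨ φ)
s ⊨ φ ∧ ψ   = (s ⊨ φ) × (s ⊨ ψ)
s ⊨ φ ∨ ψ   = (s ⊨ φ) ⊎ (s ⊨ ψ)
s ⊨ (φ ⇒ ψ) = s ⊨ φ → s ⊨ ψ
s ⊨ (φ ⇔ ψ) = (s ⊨ φ → s ⊨ ψ) × (s ⊨ ψ → s ⊨ φ)

-- Possibly infinite, and not assumed decidable.
Theory : ℕ → Set₁
Theory v = Pred (Formula v) 0ℓ

_⊨*_ : ∀ {v} → Subset v → Theory v → Set
s ⊨* Γ = ∀ φ → φ U.∈ Γ → s ⊨ φ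

_⊫_ : ∀ {v} → Theory v → Formula v → Set
Γ ⊫ φ = ∀ s → s ⊨* Γ → s ⊨ φ

Consistent : ∀ {v} → Theory v → Set
Consistent Γ = ¬ (Γ ⊫ false)

module _ {v : ℕ} (𝒱 : Pred (Subset v) 0ℓ) (Γ : Theory v) where

  Definable : Formula v → Set
  Definable φ = ∀ P → P U.∈ 𝒱 → ∃[ ψ ] (ψ over P × Γ ⊫ (φ ⇔ ψ))

  IsSufficient : (α φ : Formula v) → Set
  IsSufficient α φ = Definable φ × Γ ⊫ (φ ⇒ α)

  IsWeakestSufficient : (α φ : Formula v) → Set
  IsWeakestSufficient α φ =
    IsSufficient α φ × (∀ φ′ → IsSufficient α φ′ → Γ ⊫ (φ′ ⇒ φ))

  IsNecessary : (α φ : Formula v) → Set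
  IsNecessary α φ = Definable φ × Γ ⊫ (α ⇒ φ)

  IsStrongestNecessary : (α φ : Formula v) → Set
  IsStrongestNecessary α φ =
    IsNecessary α φ × (∀ φ′ → IsNecessary α φ′ → Γ ⊫ (φ ⇒ φ′))

record KnowledgeStructure (v n : ℕ) : Set₁ where
  field
    Γ          : Theory v
    consistent : Consistent Γ
    O          : Fin n → Subset v

  record State : Set where
    constructor state
    field
      assignment : Subset v
      satisfies  : assignment ⊨* Γ

  open State public

  𝒱 : Subset n → Pred (Subset v) 0ℓ
  𝒱 Δ P = ∃[ i ] (i ∈ Δ × P ≡ O i)

  ℰ : Subset n → State → State → Set
  ℰ Δ s s′ = ∃[ i ] (i ∈ Δ × assignment s ∩ O i ≡ assignment s′ ∩ O i)

  ℰ* : Subset n → State → State → Set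
  ℰ* Δ = TransClosure (ℰ Δ)

open KnowledgeStructure using (State; ℰ*; assignment)

data EpistemicFormula (v n : ℕ) : Set where
  var             : Fin v → EpistemicFormula v n
  true false      : EpistemicFormula v n
  ∼_              : EpistemicFormula v n → EpistemicFormula v n
  _∧_ _∨_ _⇒_ _⇔_ : (φ ψ : EpistemicFormula v n) → EpistemicFormula v n
  C               : Subset n → EpistemicFormula v n → EpistemicFormula v n

⌜_⌝ : ∀ {v n} → Formula v → EpistemicFormula v n
⌜ var p ⌝ = var p
⌜ true ⌝  = true
⌜ false ⌝ = false
⌜ ∼ φ ⌝   = ∼ ⌜ φ ⌝
⌜ φ ∧ ψ ⌝ = ⌜ φ ⌝ ∧ ⌜ ψ ⌝
⌜ φ ∨ ψ ⌝ = ⌜ φ ⌝ ∨ ⌜ ψ ⌝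
⌜ φ ⇒ ψ ⌝ = ⌜ φ ⌝ ⇒ ⌜ ψ ⌝
⌜ φ ⇔ ψ ⌝ = ⌜ φ ⌝ ⇔ ⌜ ψ ⌝

-- Γ is not assumed decidable, so C Δ φ need not be either: here, unlike for ⊨,
-- a disjunction asserts constructively that one of the disjuncts holds.
_∣_⊩_ : ∀ {v n} (𝓕 : KnowledgeStructure v n) → State 𝓕 → EpistemicFormula v n → Set
𝓕 ∣ s ⊩ var p   = p ∈ assignment s
𝓕 ∣ s ⊩ true    = ⊤
𝓕 ∣ s ⊩ false   = ⊥
𝓕 ∣ s ⊩ ∼ φ     = ¬ (𝓕 ∣ s ⊩ φ)
𝓕 ∣ s ⊩ φ ∧ ψ   = (𝓕 ∣ s ⊩ φ) × (𝓕 ∣ s ⊩ ψ)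
𝓕 ∣ s ⊩ φ ∨ ψ   = (𝓕 ∣ s ⊩ φ) ⊎ (𝓕 ∣ s ⊩ ψ)
𝓕 ∣ s ⊩ (φ ⇒ ψ) = 𝓕 ∣ s ⊩ φ → 𝓕 ∣ s ⊩ ψ
𝓕 ∣ s ⊩ (φ ⇔ ψ) = (𝓕 ∣ s ⊩ φ → 𝓕 ∣ s ⊩ ψ) × (𝓕 ∣ s ⊩ ψ → 𝓕 ∣ s ⊩ φ)
𝓕 ∣ s ⊩ C Δ φ   = ∀ s′ → ℰ* 𝓕 Δ s s′ → 𝓕 ∣ s′ ⊩ φ

{-# OPTIONS --safe #-}

-- Reachable states satisfy the same 𝒱-definable formulas, so a sufficient
-- condition of α that holds at s forces C α there. Conversely, the set of states
-- satisfying C α is closed under ℰ, so for each P ∈ 𝒱 membership of a state s in it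
-- depends on s ∩ P only; hence it is the truth set of a 𝒱-definable formula, and that
-- formula is a sufficient condition of α, so it entails the weakest one. The second
-- equivalence is dual: the negation of a strongest necessary condition of α is a
-- weakest sufficient condition of ∼ α.
--
-- Γ is arbitrary, so the set of states satisfying C α need not be decidable. As there
-- are finitely many assignments it is not not decidable, and this is enough because
-- truth of a propositional formula is a stable proposition.
module Submission where

open import Data.Bool.Properties using (_≟_)
open import Data.Empty using (⊥-elim)
open import Data.Fin using (Fin; zero; suc)
open import Data.Fin.Subset
  using (Subset; Nonempty; inside; outside; _∈_; _⊆_; _∩_; _∪_; ⊤)
open import Data.Fin.Subset.Properties
  using (_∈?_; anySubset?; drop-there; ⊥⊆; p⊆p∪q; q⊆p∪q; x∈⁅x⁆; x∈⁅y⁆⇒x≡y;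
         x∈p∩q⁺; x∈p∩q⁻; x∈p∪q⁻; ∩-identityʳ)
open import Data.Nat using (ℕ; zero; suc)
open import Data.Product using (_×_; _,_; proj₁; proj₂; ∃-syntax)
open import Data.Product.Function.NonDependent.Propositional using (_×-⇔_)
open import Data.Sum using (inj₁; inj₂) renaming ([_,_] to either)
open import Data.Sum.Function.Propositional using (_⊎-⇔_)
open import Data.Vec using ([]; _∷_; here; there)
open import Data.Vec.Properties using (≡-dec)
open import Function using (_∘_; id; mk⇔; Equivalence) renaming (_⇔_ to _iff_)
open import Function.Construct.Identity using (⇔-id)
open import Function.Related.TypeIsomorphisms using (→-cong-⇔; ¬-cong-⇔)
open import Level using (0ℓ)
open import Relation.Binary.Construct.Closure.Transitive using ([_]; _∷_)
open import Relation.Binary.PropositionalEquality using (_≡_; refl; sym; subst)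
open import Relation.Nullary using (¬_; Dec; yes; no)
open import Relation.Nullary.Decidable
  using (_×-dec_; _⊎-dec_; _→-dec_; ¬?; decidable-stable; ¬¬-excluded-middle)
open import Relation.Nullary.Negation using (contradiction; ¬¬-map)
open import Relation.Unary using (Pred; Decidable)
import Relation.Unary as U
open import Defs
open KnowledgeStructure using (Γ; O; 𝒱; ℰ*; State; state; assignment; satisfies)
open Equivalence using (to; from)

private
  variable
    k v n : ℕ

_⊨?_ : (s : Subset v) (φ : Formula v) → Dec (s ⊨ φ)
s ⊨? var p   = p ∈? s
s ⊨? true    = yes _
s ⊨? false   = no id
s ⊨? (∼ φ)   = ¬? (s ⊨? φ)
s ⊨? (φ ∧ ψ) = (s ⊨? φ) ×-dec (s ⊨? ψ)
s ⊨? (φ ∨ ψ) = (s ⊨? φ) ⊎-dec (s ⊨? ψ)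
s ⊨? (φ ⇒ ψ) = (s ⊨? φ) →-dec (s ⊨? ψ)
s ⊨? (φ ⇔ ψ) = ((s ⊨? φ) →-dec (s ⊨? ψ)) ×-dec ((s ⊨? ψ) →-dec (s ⊨? φ))

⊨-stable : (s : Subset v) (φ : Formula v) → ¬ ¬ (s ⊨ φ) → s ⊨ φ
⊨-stable s φ = decidable-stable (s ⊨? φ)

⊨-restrict : (φ : Formula v) {P : Subset v} → φ over P → ∀ s → s ⊨ φ iff s ∩ P ⊨ φ
⊨-restrict (var p) φ⊆P s =
  mk⇔ (λ p∈s → x∈p∩q⁺ (p∈s , φ⊆P (x∈⁅x⁆ p))) (proj₁ ∘ x∈p∩q⁻ _ _)
⊨-restrict true    _   s = ⇔-id _
⊨-restrict false   _   s = ⇔-id _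
⊨-restrict (∼ φ)   φ⊆P s = ¬-cong-⇔ (⊨-restrict φ φ⊆P s)
⊨-restrict (φ ∧ ψ) ⊆P  s =
  ⊨-restrict φ (⊆P ∘ p⊆p∪q _) s ×-⇔ ⊨-restrict ψ (⊆P ∘ q⊆p∪q (vars φ) _) s
⊨-restrict (φ ∨ ψ) ⊆P  s =
  ⊨-restrict φ (⊆P ∘ p⊆p∪q _) s ⊎-⇔ ⊨-restrict ψ (⊆P ∘ q⊆p∪q (vars φ) _) s
⊨-restrict (φ ⇒ ψ) ⊆P  s =
  →-cong-⇔ (⊨-restrict φ (⊆P ∘ p⊆p∪q _) s) (⊨-restrict ψ (⊆P ∘ q⊆p∪q (vars φ) _) s)
⊨-restrict (φ ⇔ ψ) ⊆P  s = →-cong-⇔ φ⇔ ψ⇔ ×-⇔ →-cong-⇔ ψ⇔ φ⇔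
  where
  φ⇔ = ⊨-restrict φ (⊆P ∘ p⊆p∪q _) s
  ψ⇔ = ⊨-restrict ψ (⊆P ∘ q⊆p∪q (vars φ) _) s

⊨-agree : (φ : Formula v) {P s t : Subset v} → φ over P → s ∩ P ≡ t ∩ P → s ⊨ φ → t ⊨ φ
⊨-agree φ φ⊆P s≡t =
  from (⊨-restrict φ φ⊆P _) ∘ subst (_⊨ φ) s≡t ∘ to (⊨-restrict φ φ⊆P _)

⌜⌝-⊨ : (𝓕 : KnowledgeStructure v n) (s : State 𝓕) (φ : Formula v) →
       𝓕 ∣ s ⊩ ⌜ φ ⌝ iff assignment s ⊨ φ
⌜⌝-⊨ 𝓕 s (var p) = ⇔-id _
⌜⌝-⊨ 𝓕 s true    = ⇔-id _
⌜⌝-⊨ 𝓕 s false   = ⇔-id _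
⌜⌝-⊨ 𝓕 s (∼ φ)   = ¬-cong-⇔ (⌜⌝-⊨ 𝓕 s φ)
⌜⌝-⊨ 𝓕 s (φ ∧ ψ) = ⌜⌝-⊨ 𝓕 s φ ×-⇔ ⌜⌝-⊨ 𝓕 s ψ
⌜⌝-⊨ 𝓕 s (φ ∨ ψ) = ⌜⌝-⊨ 𝓕 s φ ⊎-⇔ ⌜⌝-⊨ 𝓕 s ψ
⌜⌝-⊨ 𝓕 s (φ ⇒ ψ) = →-cong-⇔ (⌜⌝-⊨ 𝓕 s φ) (⌜⌝-⊨ 𝓕 s ψ)
⌜⌝-⊨ 𝓕 s (φ ⇔ ψ) =
  →-cong-⇔ (⌜⌝-⊨ 𝓕 s φ) (⌜⌝-⊨ 𝓕 s ψ) ×-⇔ →-cong-⇔ (⌜⌝-⊨ 𝓕 s ψ) (⌜⌝-⊨ 𝓕 s φ)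

∪-lub : {P Q R : Subset v} → P ⊆ R → Q ⊆ R → P ∪ Q ⊆ R
∪-lub P⊆R Q⊆R = either P⊆R Q⊆R ∘ x∈p∪q⁻ _ _

-- Shannon expansion along the first coordinate. The coordinates are read off from
-- formulas a i rather than from variables, so that the induction need not rename.
expansion : {Q : Pred (Subset k) 0ℓ} → Decidable Q →
            {P : Subset v} (a : Fin k → Formula v) → (∀ i → a i over P) →
            ∃[ ψ ] (ψ over P × (∀ s u → (∀ i → s ⊨ a i iff i ∈ u) → s ⊨ ψ iff Q u))
expansion {k = zero} Q? a a⊆P with Q? []
... | yes q = true  , ⊥⊆ , λ { _ [] _ → mk⇔ (λ _ → q) _ }
... | no ¬q = false , ⊥⊆ , λ { _ [] _ → mk⇔ ⊥-elim ¬q }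
expansion {k = suc k} Q? a a⊆P
  with ψ₁ , ψ₁⊆P , ψ₁⇔ ← expansion (Q? ∘ (inside ∷_)) (a ∘ suc) (a⊆P ∘ suc)
     | ψ₀ , ψ₀⊆P , ψ₀⇔ ← expansion (Q? ∘ (outside ∷_)) (a ∘ suc) (a⊆P ∘ suc)
  = (a zero ∧ ψ₁) ∨ (∼ a zero ∧ ψ₀)
  , ∪-lub (∪-lub (a⊆P zero) ψ₁⊆P) (∪-lub (a⊆P zero) ψ₀⊆P)
  , λ { s (inside ∷ u) a⇔ →
          let a₀ = from (a⇔ zero) here
              ih = ψ₁⇔ s u (tail⇔ a⇔)
          in mk⇔ (either (to ih ∘ proj₂) (contradiction a₀ ∘ proj₁))
                 (λ q → inj₁ (a₀ , from ih q))
      ; s (outside ∷ u) a⇔ →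
          let ¬a₀ = (λ ()) ∘ to (a⇔ zero)
              ih  = ψ₀⇔ s u (tail⇔ a⇔)
          in mk⇔ (either (⊥-elim ∘ ¬a₀ ∘ proj₁) (to ih ∘ proj₂))
                 (λ q → inj₂ (¬a₀ , from ih q)) }
  where
  tail⇔ : ∀ {s x} {u : Subset k} →
          (∀ i → s ⊨ a i iff i ∈ (x ∷ u)) → ∀ i → s ⊨ a (suc i) iff i ∈ u
  tail⇔ a⇔ i = mk⇔ (drop-there ∘ to (a⇔ (suc i))) (from (a⇔ (suc i)) ∘ there)

-- A variable outside `P` is never in `s ∩ P`, so `false` can stand for it. These formulas serve as
-- the coordinates in `expansion`, which thus sees `s ∩ P` while staying over `P`.
atom : (P : Subset v) (i : Fin v) →
       ∃[ φ ] (φ over P × (∀ s → s ⊨ φ iff i ∈ s ∩ P))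
atom P i with i ∈? P
... | yes i∈P = var i
              , (λ x∈⁅i⁆ → subst (_∈ P) (sym (x∈⁅y⁆⇒x≡y i x∈⁅i⁆)) i∈P)
              , λ s → mk⇔ (λ i∈s → x∈p∩q⁺ (i∈s , i∈P)) (proj₁ ∘ x∈p∩q⁻ s P)
... | no  i∉P = false , ⊥⊆ , λ s → mk⇔ ⊥-elim (i∉P ∘ proj₂ ∘ x∈p∩q⁻ s P)

represent : {Q : Pred (Subset v) 0ℓ} → Decidable Q → (P : Subset v) →
            ∃[ ψ ] (ψ over P × (∀ s → s ⊨ ψ iff Q (s ∩ P)))
represent Q? P
  with ψ , ψ⊆P , ψ⇔ ← expansion Q? (proj₁ ∘ atom P) (proj₁ ∘ proj₂ ∘ atom P)
  = ψ , ψ⊆P , λ s → ψ⇔ s (s ∩ P) (λ i → proj₂ (proj₂ (atom P i)) s)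

-- Excluded middle at a single assignment is not refutable, and double negation commutes with finite
-- conjunctions; the induction splits on the first coordinate.
¬¬-decidable : (Q : Pred (Subset v) 0ℓ) → ¬ ¬ Decidable Q
¬¬-decidable {zero}  Q = ¬¬-map (λ { Q? [] → Q? }) ¬¬-excluded-middle
¬¬-decidable {suc v} Q ¬Q? =
  ¬¬-decidable (Q ∘ (inside ∷_)) λ Q?₁ →
  ¬¬-decidable (Q ∘ (outside ∷_)) λ Q?₀ →
  ¬Q? λ { (inside ∷ s) → Q?₁ s ; (outside ∷ s) → Q?₀ s }

module _ (𝒱 : Pred (Subset v) 0ℓ) (Γ : Theory v) where

  definable : {Q : Pred (Subset v) 0ℓ} → Decidable Q →
              (∀ {P s t} → P U.∈ 𝒱 → s ∩ P ≡ t ∩ P → t ⊨* Γ → Q s → Q t) →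
              ∃[ φ ] (Definable 𝒱 Γ φ × (∀ s → s ⊨ φ iff Q s))
  definable {Q} Q? closed with φ , _ , φ⇔ ← represent Q? ⊤ = φ , φ-definable , φ⇔Q
    where
    φ⇔Q : ∀ s → s ⊨ φ iff Q s
    φ⇔Q s = subst (λ t → s ⊨ φ iff Q t) (∩-identityʳ s) (φ⇔ s)

    φ-definable : Definable 𝒱 Γ φ
    φ-definable P P∈𝒱
      -- The formula `ψ` projects `Q` to `P`: it holds at `s` when some `t` in `Q` agrees with `s`
      -- on `P`. From `φ` to `ψ` take `t` to be `s`; the way back is `closed`.
      with ψ , ψ⊆P , ψ⇔ ←
        represent (λ u → anySubset? λ t → Q? t ×-dec ≡-dec _≟_ (t ∩ P) u) P
      = ψ , ψ⊆P , λ s s⊨Γ →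
          (λ s⊨φ → from (ψ⇔ s) (s , to (φ⇔Q s) s⊨φ , refl)) ,
          (λ s⊨ψ → let t , Qt , t≡s = to (ψ⇔ s) s⊨ψ in
                   from (φ⇔Q s) (closed P∈𝒱 t≡s s⊨Γ Qt))

  ∼-definable : (φ : Formula v) → Definable 𝒱 Γ φ → Definable 𝒱 Γ (∼ φ)
  ∼-definable φ def P P∈𝒱 with ψ , ψ⊆P , φ⇔ψ ← def P P∈𝒱 =
    ∼ ψ , ψ⊆P , λ s s⊨Γ → let φ⇒ψ , ψ⇒φ = φ⇔ψ s s⊨Γ in _∘ ψ⇒φ , _∘ φ⇒ψ

  -- By contraposition: if `φ′` is sufficient for `∼ α`, then `∼ φ′` is necessary for `α`, so `φ`
  -- entails `∼ φ′` and hence `φ′` entails `∼ φ`.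
  ∼-weakestSufficient : (α φ : Formula v) → IsStrongestNecessary 𝒱 Γ α φ →
                        IsWeakestSufficient 𝒱 Γ (∼ α) (∼ φ)
  ∼-weakestSufficient α φ ((def , α⇒φ) , strongest) =
    (∼-definable φ def , λ s s⊨Γ ¬φ → ¬φ ∘ α⇒φ s s⊨Γ) ,
    λ φ′ (def′ , φ′⇒¬α) s s⊨Γ s⊨φ′ s⊨φ →
      strongest (∼ φ′) (∼-definable φ′ def′ , λ t t⊨Γ t⊨α t⊨φ′ → φ′⇒¬α t t⊨Γ t⊨φ′ t⊨α)
        s s⊨Γ s⊨φ s⊨φ′

module _ (𝓕 : KnowledgeStructure v n) (Δ : Subset n) where

  -- Along an edge of agent `i`, replace `φ` by its equivalent over `O 𝓕 i`, whose truth depends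
  -- only on what the two states share.
  definable-invariant : (φ : Formula v) → Definable (𝒱 𝓕 Δ) (Γ 𝓕) φ →
                        ∀ {s t} → ℰ* 𝓕 Δ s t →
                        assignment s ⊨ φ → assignment t ⊨ φ
  definable-invariant φ def {s} (_∷_ {y = r} e p) =
    definable-invariant φ def {r} p ∘ definable-invariant φ def {s} {r} [ e ]
  definable-invariant φ def {s} {t} [ i , i∈Δ , s≡t ] s⊨φ
    with ψ , ψ⊆P , φ⇔ψ ← def (O 𝓕 i) (i , i∈Δ , refl)
    = proj₂ (φ⇔ψ _ (satisfies t))
        (⊨-agree ψ ψ⊆P s≡t (proj₁ (φ⇔ψ _ (satisfies s)) s⊨φ))

  C⇔weakestSufficient : Nonempty Δ → (α φ : Formula v) →
                        IsWeakestSufficient (𝒱 𝓕 Δ) (Γ 𝓕) α φ →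
                        ∀ s → 𝓕 ∣ s ⊩ C Δ ⌜ α ⌝ iff assignment s ⊨ φ
  C⇔weakestSufficient (j , j∈Δ) α φ ((def , φ⇒α) , weakest) s = mk⇔ C⇒φ φ⇒C
    where
    φ⇒C : assignment s ⊨ φ → 𝓕 ∣ s ⊩ C Δ ⌜ α ⌝
    φ⇒C s⊨φ t s↝t =
      from (⌜⌝-⊨ 𝓕 t α) (φ⇒α _ (satisfies t) (definable-invariant φ def {s} s↝t s⊨φ))

    -- Being a model of the theory is part of the predicate, which makes it a predicate on all
    -- assignments, as `definable` expects.
    CommonlyKnown : Pred (Subset v) 0ℓ
    CommonlyKnown u = ∃[ u⊨Γ ] (𝓕 ∣ state u u⊨Γ ⊩ C Δ ⌜ α ⌝)

    closed : ∀ {P u w} → P U.∈ 𝒱 𝓕 Δ → u ∩ P ≡ w ∩ P → w ⊨* Γ 𝓕 →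
             CommonlyKnown u → CommonlyKnown w
    closed (i , i∈Δ , refl) u≡w w⊨Γ (_ , u⊩C) =
      -- Whatever is reachable from `w` is reachable from `u` through one more edge.
      w⊨Γ , λ t w↝t → u⊩C t ((i , i∈Δ , u≡w) ∷ w↝t)

    known⇒α : ∀ u → CommonlyKnown u → u ⊨ α
    -- The transitive closure does not add loops; the loop at `u` comes from the agent `j` in the
    -- nonempty `Δ`.
    known⇒α u (u⊨Γ , u⊩C) =
      to (⌜⌝-⊨ 𝓕 (state u u⊨Γ) α) (u⊩C _ [ j , j∈Δ , refl ])

    C⇒φ : 𝓕 ∣ s ⊩ C Δ ⌜ α ⌝ → assignment s ⊨ φ
    C⇒φ s⊩C = ⊨-stable _ φ (¬¬-map entailed (¬¬-decidable CommonlyKnown))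
      where
      entailed : Decidable CommonlyKnown → assignment s ⊨ φ
      entailed known?
        with κ , κ-def , κ⇔ ← definable (𝒱 𝓕 Δ) (Γ 𝓕) known? closed
        = weakest κ (κ-def , λ u _ → known⇒α u ∘ to (κ⇔ u)) _ (satisfies s)
            (from (κ⇔ _) (satisfies s , s⊩C))

theorem26 : ∀ (v n : ℕ) (𝓕 : KnowledgeStructure v n) (Δ : Subset n) → Nonempty Δ →
    (α WSC SNC : Formula v) →
    IsWeakestSufficient (𝒱 𝓕 Δ) (Γ 𝓕) α WSC →
    IsStrongestNecessary (𝒱 𝓕 Δ) (Γ 𝓕) α SNC →
    (s : State 𝓕) →
    (𝓕 ∣ s ⊩ (C Δ ⌜ α ⌝ ⇔ ⌜ WSC ⌝)) × (𝓕 ∣ s ⊩ (∼ C Δ (∼ ⌜ α ⌝) ⇔ ⌜ SNC ⌝))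
theorem26 v n 𝓕 Δ Δ≢∅ α WSC SNC wsc snc s =
  (from (⌜⌝-⊨ 𝓕 s WSC) ∘ to C⇔WSC , from C⇔WSC ∘ to (⌜⌝-⊨ 𝓕 s WSC)) ,
  -- The equivalence of `C Δ (∼ ⌜ α ⌝)` with `∼ SNC` yields only the double negation of `SNC` here,
  -- which stability removes.
  (λ ¬C → from (⌜⌝-⊨ 𝓕 s SNC) (⊨-stable _ SNC (¬C ∘ from C∼⇔∼SNC))) ,
  (λ s⊩SNC s⊩C∼α → to C∼⇔∼SNC s⊩C∼α (to (⌜⌝-⊨ 𝓕 s SNC) s⊩SNC))
  where
  C⇔WSC   = C⇔weakestSufficient 𝓕 Δ Δ≢∅ α WSC wsc s
  C∼⇔∼SNC = C⇔weakestSufficient 𝓕 Δ Δ≢∅ (∼ α) (∼ SNC) (∼-weakestSufficient _ _ α SNC snc) s
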